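{- Let $\psi$ be a first-order formula (i.e. containing no dependence atoms), let $M$ be a first-order model over a signature containing that of $\psi$, and let $X$ be a team over $M$ whose domain contains the free variables of $\psi$. Then: (1) $(M,X)\models_P^+\psi$ if and only if there is an $s\in X$ such that $M\models_s\psi$ in the usual first-order (Tarskian) sense; (2) $(M,X)\models_P^-\psi$ if and only if there is an $s\in X$ such that $M\not\models_s\psi$ in the usual first-order (Tarskian) sense.
   Context: Syntax. Over a first-order signature $\Sigma$, the formulas (of Dependence Logic, equivalently of Paraconsistent Non-dependence Logic) are $\psi ::= R\vec t \mid t_1=t_2 \mid {=}(\vec t_1,\vec t_2) \mid \lnot\psi \mid \psi\vee\psi \mid \exists v\,\psi$, where $\vec t,\vec t_1,\vec t_2$ are (possibly empty) tuples of $\Sigma$-terms; ${=}(\vec t_1,\vec t_2)$ is called a dependence atom. $\psi\wedge\theta$ abbreviates $\lnot(\lnot\psi\vee\lnot\theta)$ and $\forall v\,\psi$ abbreviates $\lnot\exists v\lnot\psi$. Free variables are defined as usual (all variables in an atom, including dependence atoms, are free). Teams. Models have nonempty domain. A team over $M$ with domain $V$ is a set $X$ of assignments $s:V\to\mathrm{Dom}(M)$. $\vec t\langle s\rangle$ denotes the value of the tuple $\vec t$ under $s$. Games. Let $\mathrm{Free}(\psi)\subseteq\mathrm{Dom}(X)$. The game $G^M_X(\psi)$ is played by Eloise and Abelard; $\alpha^*$ denotes the opponent of $\alpha$. Positions are triples $(\chi,s,\alpha)$ with $\chi$ an occurrence of a subformula of $\psi$, $s$ an assignment and $\alpha$ a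 player; the possible starting positions are $(\psi,s,\text{Eloise})$ for $s\in X$. Rules: at $(R\vec t,s,\alpha)$ or $(t_1=t_2,s,\alpha)$, $\alpha$ wins if the atom is true in $M$ under $s$, otherwise $\alpha^*$ wins; at $({=}(\vec t_1,\vec t_2),s,\alpha)$, $\alpha$ wins; from $(\lnot\chi,s,\alpha)$ the game moves to $(\chi,s,\alpha^*)$; from $(\chi\vee\theta,s,\alpha)$, $\alpha$ chooses $(\chi,s,\alpha)$ or $(\theta,s,\alpha)$; from $(\exists v\chi,s,\alpha)$, $\alpha$ chooses $m\in\mathrm{Dom}(M)$ and the game moves to $(\chi,s[m/v],\alpha)$. A (possibly nondeterministic) strategy for a player selects a nonempty set of allowed successors at each position where that player chooses; it is winning if every play from any starting position in which the player's choices conform to it is won by that player. A strategy for $\alpha$ is uniform if for any two plays conforming to it and ending in $({=}(\vec t_1,\vec t_2),s,\alpha)$ and $({=}(\vec t_1,\vec t_2),s',\alpha)$ for the same occurrence of the dependence atom, $\vec t_1\langle s\rangle=\vec t_1\langle s'\rangle$ implies $\vec t_2\langle s\rangle=\vec t_2\langle s'\rangle$. Paraconsistent satisfaction. $(M,X)\models_P^+\psi$ iff Abelard has no uniform winning strategy in $G^M_X(\psi)$; $(M,X)\models_P^-\psi$ iff Eloise has no uniform winning strategy in $G^M_X(\psi)$. -}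

module Defs where

open import Level using (Level; 0ℓ; _⊔_) renaming (suc to lsuc)
open import Data.Empty using (⊥-elim)
import Data.Empty.Polymorphic as ⊥ₚ
open import Data.Nat using (ℕ; _≟_)
open import Data.Product using (∃; Σ-syntax; _×_; _,_)
open import Data.Sum using (_⊎_; inj₁; inj₂)
import Data.Unit.Polymorphic as ⊤ₚ
open import Data.Vec using (Vec; []; _∷_)
open import Data.Vec.Relation.Unary.Any using (Any; here; there)
open import Function using (_∘_)
open import Relation.Binary.Construct.Closure.ReflexiveTransitive using (Star)
open import Relation.Binary.PropositionalEquality using (_≡_; _≢_; refl; sym)
open import Relation.Nullary using (¬_; yes; no)
open import Relation.Unary using (Pred; _∈_; _⊆_; _∪_; ｛_｝; Satisfiable)

Var : Set
Var = ℕ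

record Signature (ℓ : Level) : Set (lsuc ℓ) where
  field
    Fun      : Set ℓ
    funArity : Fun → ℕ
    Rel      : Set ℓ
    relArity : Rel → ℕ

module _ {ℓ : Level} (S : Signature ℓ) where
  open Signature S

  data Term : Set ℓ where
    var : Var → Term
    fun : (f : Fun) → Vec Term (funArity f) → Term

  infix  8 _≐_
  infix  7 ¬′_
  infixr 6 _∨′_

  data Formula : Set ℓ where
    rel  : (R : Rel) → Vec Term (relArity R) → Formula
    _≐_  : Term → Term → Formula
    dep  : {m n : ℕ} → Vec Term m → Vec Term n → Formula
    ¬′_  : Formula → Formula
    _∨′_ : Formula → Formula → Formula
    ∃′   : Var → Formula → Formula

  record Structure : Set (lsuc ℓ) where
    field
      Dom   : Set ℓ
      point : Dom  -- the domain is nonempty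
      funI  : (f : Fun) → Vec Dom (funArity f) → Dom
      relI  : (R : Rel) → Pred (Vec Dom (relArity R)) ℓ

module _ {ℓ : Level} {S : Signature ℓ} where

  FirstOrder : Formula S → Set ℓ
  FirstOrder (rel R ts) = ⊤ₚ.⊤
  FirstOrder (t ≐ u)    = ⊤ₚ.⊤
  FirstOrder (dep ts us) = ⊥ₚ.⊥
  FirstOrder (¬′ χ)     = FirstOrder χ
  FirstOrder (χ ∨′ θ)   = FirstOrder χ × FirstOrder θ
  FirstOrder (∃′ v χ)   = FirstOrder χ

  data OccursIn (x : Var) : Term S → Set ℓ where
    var : OccursIn x (var x)
    fun : ∀ {f ts} → Any (OccursIn x) ts → OccursIn x (fun f ts)

  Vars : Term S → Pred Var ℓ
  Vars t x = OccursIn x t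

  Varsⁿ : {n : ℕ} → Vec (Term S) n → Pred Var ℓ
  Varsⁿ ts x = Any (OccursIn x) ts

  Free : Formula S → Pred Var ℓ
  Free (rel R ts)    = Varsⁿ ts
  Free (t ≐ u)       = Vars t ∪ Vars u
  Free (dep ts us)   = Varsⁿ ts ∪ Varsⁿ us
  Free (¬′ χ)        = Free χ
  Free (χ ∨′ θ)      = Free χ ∪ Free θ
  Free (∃′ v χ) x    = x ∈ Free χ × x ≢ v

  Free-∃′ : ∀ {v χ} {V : Pred Var 0ℓ} → Free (∃′ v χ) ⊆ V → Free χ ⊆ V ∪ ｛ v ｝
  Free-∃′ {v} p {x} x∈χ with v ≟ x
  ... | yes v≡x = inj₂ v≡x
  ... | no  v≢x = inj₁ (p (x∈χ , v≢x ∘ sym))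

  -- An occurrence of χ in ψ is a path from the root of ψ to χ, so distinct
  -- occurrences of the same subformula are kept apart.
  data _∋_ (ψ : Formula S) : Formula S → Set ℓ where
    root  : ψ ∋ ψ
    neg   : ∀ {χ} → ψ ∋ (¬′ χ) → ψ ∋ χ
    left  : ∀ {χ θ} → ψ ∋ (χ ∨′ θ) → ψ ∋ χ
    right : ∀ {χ θ} → ψ ∋ (χ ∨′ θ) → ψ ∋ θ
    body  : ∀ {v χ} → ψ ∋ (∃′ v χ) → ψ ∋ χ

data Player : Set where
  Eloise Abelard : Player

opponent : Player → Player
opponent Eloise  = Abelard
opponent Abelard = Eloise

module _ {ℓ : Level} {S : Signature ℓ} (M : Structure S) where
  open Signature S
  open Structure M

  -- Functions V → Dom. The membership proof is irrelevant, so that the value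
  -- of a variable depends on the variable only.
  Assignment : Pred Var 0ℓ → Set ℓ
  Assignment V = (x : Var) → .(x ∈ V) → Dom

  Team : Pred Var 0ℓ → Set (lsuc ℓ)
  Team V = Pred (Assignment V) ℓ

  update : ∀ {V} → Assignment V → (v : Var) → Dom → Assignment (V ∪ ｛ v ｝)
  update {V} s v m x x∈ with v ≟ x
  ... | yes _   = m
  ... | no  v≢x = s x (old x∈)
    where
    old : x ∈ (V ∪ ｛ v ｝) → x ∈ V
    old (inj₁ x∈V) = x∈V
    old (inj₂ v≡x) = ⊥-elim (v≢x v≡x)

  mutual
    eval : ∀ {V} (t : Term S) → .(Vars t ⊆ V) → Assignment V → Dom
    eval (var x)    p s = s x (p var)
    eval (fun f ts) p s = funI f (evalⁿ ts (λ q → p (fun q)) s)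

    evalⁿ : ∀ {V n} (ts : Vec (Term S) n) → .(Varsⁿ ts ⊆ V) → Assignment V → Vec Dom n
    evalⁿ []       p s = []
    evalⁿ (t ∷ ts) p s = eval t (λ q → p (here q)) s ∷ evalⁿ ts (λ q → p (there q)) s

  Tarski : ∀ {V} (ψ : Formula S) → FirstOrder ψ → .(Free ψ ⊆ V) → Assignment V → Set ℓ
  Tarski (rel R ts) fo p s = relI R (evalⁿ ts p s)
  Tarski (t ≐ u)    fo p s = eval t (λ q → p (inj₁ q)) s ≡ eval u (λ q → p (inj₂ q)) s
  Tarski (dep _ _)  ()
  Tarski (¬′ χ)     fo p s = ¬ Tarski χ fo p s
  Tarski (χ ∨′ θ)   (foχ , foθ) p s =
    Tarski χ foχ (λ q → p (inj₁ q)) s ⊎ Tarski θ foθ (λ q → p (inj₂ q)) s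
  Tarski (∃′ v χ)   fo p s =
    ∃ λ m → Tarski χ fo (λ {x} → Free-∃′ {χ = χ} p {x}) (update s v m)

  module Game (ψ : Formula S) where

    record Position : Set (lsuc 0ℓ ⊔ ℓ) where
      constructor position
      field
        {formula}  : Formula S
        occurrence : ψ ∋ formula
        {domain}   : Pred Var 0ℓ
        .scope     : Free formula ⊆ domain
        assignment : Assignment domain
        player     : Player
    open Position using (formula; player)

    data Move : Formula S → Set ℓ where
      swap       : ∀ {χ} → Move (¬′ χ)
      goˡ goʳ    : ∀ {χ θ} → Move (χ ∨′ θ)
      pick       : ∀ {v χ} → Dom → Move (∃′ v χ)

    next : (p : Position) → Move (formula p) → Position
    next (position o f s α) swap     = position (neg o) f s (opponent α)
    next (position o f s α) goˡ      = position (left o) (λ q → f (inj₁ q)) s α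
    next (position o f s α) goʳ      = position (right o) (λ q → f (inj₂ q)) s α
    next (position {∃′ v χ} o f s α) (pick m) =
      position (body o) (λ {x} → Free-∃′ {χ = χ} f {x}) (update s v m) α

    data IsChoice : Formula S → Set ℓ where
      or : ∀ {χ θ} → IsChoice (χ ∨′ θ)
      ex : ∀ {v χ} → IsChoice (∃′ v χ)

    Turn : Player → Position → Set ℓ
    Turn α p = IsChoice (formula p) × player p ≡ α

    -- Distinct moves lead to distinct positions, so a set of successors is
    -- given as a set of moves.
    record Strategy (α : Player) : Set (lsuc ℓ) where
      field
        allowed  : (p : Position) → Turn α p → Pred (Move (formula p)) ℓ
        nonempty : (p : Position) (t : Turn α p) → Satisfiable (allowed p t)
    open Strategy

    data Step {α : Player} (σ : Strategy α) : Position → Position → Set (lsuc 0ℓ ⊔ ℓ) where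
      step : ∀ {p} (m : Move (formula p)) → ((t : Turn α p) → m ∈ allowed σ p t) →
             Step σ p (next p m)

    Terminal : Position → Set ℓ
    Terminal p = ¬ Move (formula p)

    WonBy : Player → Position → Set ℓ
    WonBy β (position {rel R ts} _ f s α) =
      (β ≡ α × relI R (evalⁿ ts f s)) ⊎ (β ≡ opponent α × ¬ relI R (evalⁿ ts f s))
    WonBy β (position {t ≐ u} _ f s α) =
      (β ≡ α × a ≡ b) ⊎ (β ≡ opponent α × a ≢ b)
      where
      a = eval t (λ q → f (inj₁ q)) s
      b = eval u (λ q → f (inj₂ q)) s
    WonBy β (position {dep _ _} _ _ _ α) = ⊤ₚ.⊤ {ℓ} × β ≡ α
    WonBy β (position {¬′ _}   _ _ _ _)  = ⊥ₚ.⊥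
    WonBy β (position {_ ∨′ _} _ _ _ _)  = ⊥ₚ.⊥
    WonBy β (position {∃′ _ _} _ _ _ _)  = ⊥ₚ.⊥

    module _ {V : Pred Var 0ℓ} (X : Team V) .(fv : Free ψ ⊆ V) {α : Player} (σ : Strategy α) where

      -- A play from a starting position to the terminal position q in which
      -- α conforms to σ.
      Play : Position → Set (lsuc 0ℓ ⊔ ℓ)
      Play q = Terminal q × Σ[ s ∈ Assignment V ]
        s ∈ X × Star (Step σ) (position root fv s Eloise) q

      -- Every play is finite, since each move passes to a proper subformula,
      -- and it can stop only at an atom, since the domain is nonempty.
      Winning : Set (lsuc 0ℓ ⊔ ℓ)
      Winning = ∀ {q} → Play q → WonBy α q

      Uniform : Set (lsuc 0ℓ ⊔ ℓ)
      Uniform =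
        ∀ {m n} {ts : Vec (Term S) m} {us : Vec (Term S) n} (o : ψ ∋ dep ts us)
          {W W′ : Pred Var 0ℓ}
          .(f : Free (dep ts us) ⊆ W) .(f′ : Free (dep ts us) ⊆ W′)
          (s : Assignment W) (s′ : Assignment W′) →
        Play (position o f s α) → Play (position o f′ s′ α) →
        evalⁿ ts (λ q → f (inj₁ q)) s ≡ evalⁿ ts (λ q → f′ (inj₁ q)) s′ →
        evalⁿ us (λ q → f (inj₂ q)) s ≡ evalⁿ us (λ q → f′ (inj₂ q)) s′

    HasUniformWinningStrategy : (α : Player) {V : Pred Var 0ℓ} → Team V → .(Free ψ ⊆ V) →
                                Set (lsuc ℓ)
    HasUniformWinningStrategy α X fv =
      Σ[ σ ∈ Strategy α ] Uniform X fv σ × Winning X fv σ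

  open Game using (HasUniformWinningStrategy)

  Sat⁺ : ∀ {V} → Team V → (ψ : Formula S) → .(Free ψ ⊆ V) → Set (lsuc ℓ)
  Sat⁺ X ψ fv = ¬ HasUniformWinningStrategy ψ Abelard X fv

  Sat⁻ : ∀ {V} → Team V → (ψ : Formula S) → .(Free ψ ⊆ V) → Set (lsuc ℓ)
  Sat⁻ X ψ fv = ¬ HasUniformWinningStrategy ψ Eloise X fv

{-# OPTIONS --safe #-}

-- For a first-order ψ uniformity is vacuous, and the game is determined by the
-- Tarskian truth values: a player wins from (χ, s, α) exactly when it is α and
-- χ holds at s, or it is α's opponent and χ fails at s. A winning strategy
-- keeps χ true whenever possible; conversely, any winning strategy certifies
-- the truth value by induction on χ. So a player has a winning strategy iff the
-- truth value of ψ is in its favour at every s ∈ X, and the theorem negates this.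
module Submission where

open import Defs
open import Level using (Level; 0ℓ)
open import Axiom.ExcludedMiddle using (ExcludedMiddle)
open import Axiom.DoubleNegationElimination using (em⇒dne)
open import Data.Empty using (⊥-elim)
open import Data.Product using (∃; _×_; _,_; proj₁; proj₂; map₂)
open import Data.Sum using (_⊎_; inj₁; inj₂; [_,_])
open import Function using (_∘_; id; const)
open import Function.Bundles using (_⇔_; mk⇔; Equivalence)
open import Relation.Binary.Construct.Closure.ReflexiveTransitive using (Star; ε; _◅_)
open import Relation.Binary.PropositionalEquality using (_≡_; _≢_; refl; sym)
open import Relation.Nullary using (¬_; yes; no)
open import Relation.Unary using (Pred; _∈_; _⊆_)

opponent-involutive : ∀ α → opponent (opponent α) ≡ α
opponent-involutive Eloise  = refl
opponent-involutive Abelard = refl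

opponent-≢ : ∀ α → α ≢ opponent α
opponent-≢ Eloise  ()
opponent-≢ Abelard ()

same-or-opponent : ∀ β α → β ≡ α ⊎ β ≡ opponent α
same-or-opponent Eloise  Eloise  = inj₁ refl
same-or-opponent Eloise  Abelard = inj₂ refl
same-or-opponent Abelard Eloise  = inj₂ refl
same-or-opponent Abelard Abelard = inj₁ refl

FirstOrder-∋ : ∀ {ℓ} {S : Signature ℓ} {ψ χ : Formula S} →
               FirstOrder ψ → ψ ∋ χ → FirstOrder χ
FirstOrder-∋ fo root      = fo
FirstOrder-∋ fo (neg o)   = FirstOrder-∋ fo o
FirstOrder-∋ fo (left o)  = proj₁ (FirstOrder-∋ fo o)
FirstOrder-∋ fo (right o) = proj₂ (FirstOrder-∋ fo o)
FirstOrder-∋ fo (body o)  = FirstOrder-∋ fo o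

module _ {ℓ : Level} {S : Signature ℓ} (M : Structure S)
         (ψ : Formula S) (fo : FirstOrder ψ) where
  open Structure M using (point)
  open Game M ψ
  open Position using (player)
  open Strategy using (allowed; nonempty)

  no-dep : ∀ {m n ts us} → ¬ (ψ ∋ dep {m = m} {n = n} ts us)
  no-dep o with () ← FirstOrder-∋ fo o

  -- The first-order witness is read off the occurrence, so `Holds (next p m)` reduces to the
  -- matching component of `Holds p`.
  Holds : Position → Set ℓ
  Holds (position {χ} o f s α) = Tarski M χ (FirstOrder-∋ fo o) f s

  -- On relational and equality atoms this unfolds to `WonBy`; Tarskian truth extends it to compound
  -- formulas.
  Favours : Player → Position → Set ℓ
  Favours β p = (β ≡ player p × Holds p) ⊎ (β ≡ opponent (player p) × ¬ Holds p)

  favours⇒wonBy : ∀ {β} p → Terminal p → Favours β p → WonBy β p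
  favours⇒wonBy (position {rel R ts} o f s α) t w = w
  favours⇒wonBy (position {x ≐ y}    o f s α) t w = w
  favours⇒wonBy (position {dep _ _}  o f s α) t w = ⊥-elim (no-dep o)
  favours⇒wonBy (position {¬′ χ}     o f s α) t w = ⊥-elim (t swap)
  favours⇒wonBy (position {χ ∨′ θ}   o f s α) t w = ⊥-elim (t goˡ)
  favours⇒wonBy (position {∃′ v χ}   o f s α) t w = ⊥-elim (t (pick point))

  module _ (em : ExcludedMiddle ℓ) {β : Player} where

    keepTrue : Strategy β
    allowed  keepTrue p _ m = Holds p → Holds (next p m)
    nonempty keepTrue (position {χ ∨′ θ} o f s α) (or , refl)
      with em {Tarski M χ (proj₁ (FirstOrder-∋ fo o)) (λ q → f (inj₁ q)) s}
    ... | yes h = goˡ , const h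
    -- With the left disjunct false, a true disjunction must be true on the right; if both fail, the
    -- condition on the move is vacuous.
    ... | no ¬h = goʳ , [ ⊥-elim ∘ ¬h , id ]
    nonempty keepTrue p@(position {∃′ v χ} o f s α) (ex , refl)
      with em {Holds p}
    ... | yes (m , h) = pick m , const h
    -- No witness exists, so every move is allowed and any element of the domain will do.
    ... | no ¬h       = pick point , ⊥-elim ∘ ¬h

    -- On the turn of `β` the strategy itself preserves truth. On the opponent's turn a false
    -- disjunction or existential has only false successors. Negation exchanges both the roles and
    -- the truth values.
    keepTrue-step : ∀ {p q} → Step keepTrue p q → Favours β p → Favours β q
    keepTrue-step (step {position o f s α} swap _) (inj₁ (refl , ¬h)) =
      inj₂ (sym (opponent-involutive α) , ¬h)
    keepTrue-step (step swap _)     (inj₂ (refl , ¬¬h)) = inj₁ (refl , em⇒dne em ¬¬h)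
    keepTrue-step (step goˡ c)      (inj₁ (refl , h))   = inj₁ (refl , c (or , refl) h)
    keepTrue-step (step goˡ _)      (inj₂ (refl , ¬h))  = inj₂ (refl , ¬h ∘ inj₁)
    keepTrue-step (step goʳ c)      (inj₁ (refl , h))   = inj₁ (refl , c (or , refl) h)
    keepTrue-step (step goʳ _)      (inj₂ (refl , ¬h))  = inj₂ (refl , ¬h ∘ inj₂)
    keepTrue-step (step (pick m) c) (inj₁ (refl , h))   = inj₁ (refl , c (ex , refl) h)
    keepTrue-step (step (pick m) _) (inj₂ (refl , ¬h))  = inj₂ (refl , ¬h ∘ (m ,_))

    keepTrue-play : ∀ {p q} → Star (Step keepTrue) p q → Favours β p → Favours β q
    keepTrue-play ε        w = w
    keepTrue-play (x ◅ xs) w = keepTrue-play xs (keepTrue-step x w)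

  module _ {β : Player} (σ : Strategy β) where

    -- Plays may start at any position here, which lets the induction descend to successors.
    WinningFrom : Position → Set _
    WinningFrom p = ∀ {q} → Terminal q → Star (Step σ) p q → WonBy β q

    winningFrom-next : ∀ p m → ((t : Turn β p) → m ∈ allowed σ p t) →
                       WinningFrom p → WinningFrom (next p m)
    winningFrom-next p m c w t xs = w t (step m c ◅ xs)

    not-turn : ∀ p → β ≡ opponent (player p) → ¬ Turn β p
    not-turn p β≡ (_ , refl) = opponent-≢ (player p) β≡

    holds-of-favours : ∀ p → β ≡ player p → Favours β p → Holds p
    holds-of-favours p β≡   (inj₁ (_ , h))  = h
    holds-of-favours p refl (inj₂ (β≡ , _)) = ⊥-elim (opponent-≢ (player p) β≡)

    fails-of-favours : ∀ p → β ≡ opponent (player p) → Favours β p → ¬ Holds p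
    fails-of-favours p β≡ (inj₂ (_ , ¬h))   = ¬h
    fails-of-favours p β≡ (inj₁ (refl , _)) = ⊥-elim (opponent-≢ (player p) β≡)

    -- Induction on `χ`. On the turn of `β` one allowed move already gives truth; on the opponent's
    -- turn every move conforms to `σ`, so all successors must be false.
    winningFrom⇒favours : ∀ {χ} (o : ψ ∋ χ) {W : Pred Var 0ℓ} .(f : Free χ ⊆ W)
      (s : Assignment M W) α → WinningFrom (position o f s α) → Favours β (position o f s α)
    -- An atom admits no move, so the empty play is complete and its outcome is the claim.
    winningFrom⇒favours {rel R ts} o f s α w = w (λ ()) ε
    winningFrom⇒favours {x ≐ y}    o f s α w = w (λ ()) ε
    winningFrom⇒favours {dep _ _}  o f s α w = ⊥-elim (no-dep o)
    winningFrom⇒favours {¬′ χ}     o f s α w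
      with winningFrom⇒favours (neg o) f s (opponent α)
             (winningFrom-next (position o f s α) swap (λ { (() , _) }) w)
    ... | inj₁ (β≡ , h)    = inj₂ (β≡ , λ ¬h → ¬h h)
    ... | inj₂ (refl , ¬h) = inj₁ (opponent-involutive α , ¬h)
    winningFrom⇒favours {χ ∨′ θ}   o f s α w
      with same-or-opponent β α
    ... | inj₂ β≡ = inj₂ (β≡ ,
        [ fails-of-favours (next p goˡ) β≡ (winningFrom⇒favours (left o) _ s α
            (winningFrom-next p goˡ (⊥-elim ∘ not-turn p β≡) w))
        , fails-of-favours (next p goʳ) β≡ (winningFrom⇒favours (right o) _ s α
            (winningFrom-next p goʳ (⊥-elim ∘ not-turn p β≡) w)) ])
      where p = position o f s α
    ... | inj₁ refl with nonempty σ (position o f s α) (or , refl)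
    ...   | goˡ , c = inj₁ (refl , inj₁ (holds-of-favours (next p goˡ) refl
              (winningFrom⇒favours (left o) _ s α
                (winningFrom-next p goˡ (λ { (or , refl) → c }) w))))
      where p = position o f s α
    ...   | goʳ , c = inj₁ (refl , inj₂ (holds-of-favours (next p goʳ) refl
              (winningFrom⇒favours (right o) _ s α
                (winningFrom-next p goʳ (λ { (or , refl) → c }) w))))
      where p = position o f s α
    winningFrom⇒favours {∃′ v χ}   o f s α w
      with same-or-opponent β α
    ... | inj₂ β≡ = inj₂ (β≡ , λ (m , h) →
        fails-of-favours (next p (pick m)) β≡
          (winningFrom⇒favours (body o) _ (update M s v m) α
            (winningFrom-next p (pick m) (⊥-elim ∘ not-turn p β≡) w)) h)
      where p = position o f s α
    -- The element offered by `σ` serves as the Tarskian witness.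
    ... | inj₁ refl with nonempty σ (position o f s α) (ex , refl)
    ...   | pick m , c = inj₁ (refl , m , holds-of-favours (next p (pick m)) refl
              (winningFrom⇒favours (body o) _ (update M s v m) α
                (winningFrom-next p (pick m) (λ { (ex , refl) → c }) w)))
      where p = position o f s α

  module _ (em : ExcludedMiddle ℓ) {V : Pred Var 0ℓ} (X : Team M V) (fv : Free ψ ⊆ V)
           (β : Player) where

    start : Assignment M V → Position
    start s = position root fv s Eloise

    uniformWinning⇔favours :
      HasUniformWinningStrategy β X fv ⇔ (∀ s → s ∈ X → Favours β (start s))
    uniformWinning⇔favours = mk⇔
      (λ (σ , _ , win) s s∈X →
         winningFrom⇒favours σ root fv s Eloise (λ t xs → win (t , s , s∈X , xs)))
      (λ fav → keepTrue em , (λ {_ _ _ _} o → ⊥-elim (no-dep o)) ,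
         λ {q} (t , s , s∈X , xs) →
           favours⇒wonBy q t (keepTrue-play em xs (fav s s∈X)))

    -- Excluded middle turns the failure of a universal statement over `X` into a concrete
    -- assignment.
    no-uniformWinning⇔unfavourable :
      (¬ HasUniformWinningStrategy β X fv) ⇔ (∃ λ s → s ∈ X × ¬ Favours β (start s))
    no-uniformWinning⇔unfavourable = mk⇔
      (λ none → em⇒dne em λ ¬∃ → none (from λ s s∈X →
         em⇒dne em λ ¬fav → ¬∃ (s , s∈X , ¬fav)))
      (λ (s , s∈X , ¬fav) hasStrategy → ¬fav (to hasStrategy s s∈X))
      where open Equivalence uniformWinning⇔favours using (to; from)

theorem3p3 : {ℓ : Level} → ExcludedMiddle ℓ →
    (S : Signature ℓ) (ψ : Formula S) (fo : FirstOrder ψ)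
    (M : Structure S) (V : Pred Var 0ℓ) (X : Team M V) (fv : Free ψ ⊆ V) →
    (Sat⁺ M X ψ fv ⇔ (∃ λ s → s ∈ X × Tarski M ψ fo fv s)) ×
    (Sat⁻ M X ψ fv ⇔ (∃ λ s → s ∈ X × ¬ Tarski M ψ fo fv s))
theorem3p3 em S ψ fo M V X fv =
  -- Every play starts with Eloise in the player slot, so Abelard is favoured only by falsity of `ψ`
  -- and Eloise only by its truth.
  mk⇔ (map₂ (map₂ λ ¬fav → em⇒dne em λ ¬h → ¬fav (inj₂ (refl , ¬h))) ∘ to⁺)
      (from⁺ ∘ map₂ (map₂ λ { h (inj₂ (_ , ¬h)) → ¬h h })) ,
  mk⇔ (map₂ (map₂ λ ¬fav h → ¬fav (inj₁ (refl , h))) ∘ to⁻)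
      (from⁻ ∘ map₂ (map₂ λ { ¬h (inj₁ (_ , h)) → ¬h h }))
  where
  open Equivalence (no-uniformWinning⇔unfavourable M ψ fo em X fv Abelard)
    renaming (to to to⁺; from to from⁺)
  open Equivalence (no-uniformWinning⇔unfavourable M ψ fo em X fv Eloise)
    renaming (to to to⁻; from to from⁻)
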